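{- Let $k \ge 2$ and $\delta \ge 1$ be integers. If $F_1, F_2, \ldots, F_k$ are graphs on a common set of $n$ vertices, each of which has minimum degree at least $\delta$, then \[ \gamma_{\rm sd}(F_1,F_2,\ldots,F_k) \le \left( 1 - \left( \frac{\delta}{\delta + 1} \right) \left( \frac{1}{k(\delta + 1)} \right)^{\frac{1}{\delta}} \right) n. \]
   Context: All graphs are finite and simple. Given graphs $F_1,\ldots,F_k$ (called factors; not necessarily edge-disjoint) with common vertex set $V$, a set $S \subseteq V$ is a simultaneous dominating set if for every $i$, $1 \le i \le k$, every vertex not in $S$ is adjacent in $F_i$ to some vertex of $S$. The simultaneous domination number $\gamma_{\rm sd}(F_1,\ldots,F_k)$ is the minimum cardinality of a simultaneous dominating set. -}

module Defs where

open import Data.Nat.Base as Nat using (ℕ)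

-- The standard library has no real numbers: the ones used here are Cauchy
-- sequences of rationals, compared by their limits.
module Reals where

  import Algebra.Definitions.RawSemiring
  open import Data.Integer.Base as ℤ using (+_; -[1+_])
  import Data.Integer.Properties as ℤ
  open import Data.Nat.Base as ℕ using (zero; suc)
  import Data.Nat.Properties as ℕ
  open import Data.Product.Base using (_×_; _,_; proj₁; proj₂; ∃)
  open import Data.Rational.Base
  open import Data.Rational.Properties
  open import Data.Rational.Solver using (module +-*-Solver)
  import Data.Rational.Unnormalised.Base as ℚᵘ
  import Data.Rational.Unnormalised.Properties as ℚᵘ
  open import Relation.Binary.PropositionalEquality
    using (_≡_; refl; sym; trans; cong; cong₂; subst)
  open import Data.Sum.Base using (inj₁; inj₂)
  open import Relation.Nullary.Decidable using (yes; no)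

  open +-*-Solver using (solve; _:=_; _:+_; _:*_; _:-_; :-_; con)
  open ≤-Reasoning
  open Algebra.Definitions.RawSemiring +-*-rawSemiring using (_^_)

  IsCauchy : (ℕ → ℚ) → Set
  IsCauchy x = ∀ ε → 0ℚ < ε → ∃ λ N → ∀ m n → N ℕ.≤ m → N ℕ.≤ n → ∣ x m - x n ∣ < ε

  record ℝ : Set where
    constructor mkℝ
    field
      seq    : ℕ → ℚ
      cauchy : IsCauchy seq

  open ℝ public

  infix 4 _≤ᵣ_ _≃ᵣ_

  _≤ᵣ_ : ℝ → ℝ → Set
  x ≤ᵣ y = ∀ ε → 0ℚ < ε → ∃ λ N → ∀ n → N ℕ.≤ n → seq x n ≤ seq y n + ε

  _≃ᵣ_ : ℝ → ℝ → Set
  x ≃ᵣ y = x ≤ᵣ y × y ≤ᵣ x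

  fromℚ : ℚ → ℝ
  fromℚ q = mkℝ (λ _ → q) λ ε 0<ε → 0 , λ _ _ _ _ → subst (_< ε) (cong ∣_∣ (sym (+-inverseʳ q))) 0<ε

  fromℕ : ℕ → ℝ
  fromℕ n = fromℚ (+ n / 1)

  private
    half-pos : ∀ {ε} → 0ℚ < ε → 0ℚ < ε * ½
    half-pos {ε} 0<ε = begin-strict
      0ℚ      ≡⟨ *-zeroˡ ½ ⟨
      0ℚ * ½  <⟨ *-monoˡ-<-pos ½ 0<ε ⟩
      ε * ½   ∎

    halves : ∀ ε → ε * ½ + ε * ½ ≡ ε
    halves = solve 1 (λ e → e :* con ½ :+ e :* con ½ := e) refl

    minus-cauchy : ∀ x y → IsCauchy (λ n → seq x n - seq y n)
    minus-cauchy (mkℝ x cx) (mkℝ y cy) ε 0<ε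
      with (M , p) ← cx (ε * ½) (half-pos 0<ε)
         | (N , q) ← cy (ε * ½) (half-pos 0<ε)
      = M ℕ.⊔ N , λ m n m≥ n≥ → begin-strict
        ∣ (x m - y m) - (x n - y n) ∣    ≡⟨ cong ∣_∣ (rearrange (x m) (y m) (x n) (y n)) ⟩
        ∣ (x m - x n) - (y m - y n) ∣    ≤⟨ ∣p-q∣≤∣p∣+∣q∣ (x m - x n) (y m - y n) ⟩
        ∣ x m - x n ∣ + ∣ y m - y n ∣
          <⟨ +-mono-< (p m n (ℕ.m⊔n≤o⇒m≤o M N m≥) (ℕ.m⊔n≤o⇒m≤o M N n≥))
                      (q m n (ℕ.m⊔n≤o⇒n≤o M N m≥) (ℕ.m⊔n≤o⇒n≤o M N n≥)) ⟩
        ε * ½ + ε * ½                    ≡⟨ halves ε ⟩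
        ε                                ∎
      where
      rearrange : ∀ a b c d → (a - b) - (c - d) ≡ (a - c) - (b - d)
      rearrange = solve 4 (λ a b c d → (a :- b) :- (c :- d) := (a :- c) :- (b :- d)) refl

    eventually-bounded : ∀ x → ∃ λ N → ∃ λ B → 0ℚ < B × (∀ n → N ℕ.≤ n → ∣ seq x n ∣ < B)
    eventually-bounded (mkℝ x cx) with (N , p) ← cx 1ℚ (positive⁻¹ 1ℚ) =
      N , 1ℚ + ∣ x N ∣ , B>0 , λ n n≥ → begin-strict
        ∣ x n ∣                ≡⟨ cong ∣_∣ (split (x n) (x N)) ⟩
        ∣ (x n - x N) + x N ∣  ≤⟨ ∣p+q∣≤∣p∣+∣q∣ (x n - x N) (x N) ⟩
        ∣ x n - x N ∣ + ∣ x N ∣ <⟨ +-monoˡ-< ∣ x N ∣ (p n N n≥ ℕ.≤-refl) ⟩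
        1ℚ + ∣ x N ∣           ∎
      where
      split : ∀ a b → a ≡ (a - b) + b
      split = solve 2 (λ a b → a := (a :- b) :+ b) refl
      B>0 : 0ℚ < 1ℚ + ∣ x N ∣
      B>0 = +-mono-<-≤ (positive⁻¹ 1ℚ) (0≤∣p∣ (x N))

    rescale : ∀ B ε → 0ℚ < B → 0ℚ < ε → ∃ λ e → 0ℚ < e × B * e ≡ ε
    rescale B ε 0<B 0<ε = ε * 1/ B , 0<e , Be
      where
      instance
        B-nonZero : NonZero B
        B-nonZero = pos⇒nonZero B {{positive 0<B}}
      0<e : 0ℚ < ε * 1/ B
      0<e = subst (_< ε * 1/ B) (*-zeroˡ (1/ B))
        (*-monoˡ-<-pos (1/ B) {{1/pos⇒pos B {{positive 0<B}}}} 0<ε)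
      Be : B * (ε * 1/ B) ≡ ε
      Be = trans (*-comm B (ε * 1/ B)) (trans (*-assoc ε (1/ B) B)
             (trans (cong (ε *_) (*-inverseˡ B)) (*-identityʳ ε)))

    *-mono-abs : ∀ {B e} a b → 0ℚ < B → ∣ a ∣ < B → ∣ b ∣ < e → ∣ a * b ∣ < B * e
    *-mono-abs {B} {e} a b 0<B a<B b<e = begin-strict
      ∣ a * b ∣      ≡⟨ ∣p*q∣≡∣p∣*∣q∣ a b ⟩
      ∣ a ∣ * ∣ b ∣  ≤⟨ *-monoʳ-≤-nonNeg ∣ b ∣ {{∣-∣-nonNeg b}} (<⇒≤ a<B) ⟩
      B * ∣ b ∣      <⟨ *-monoʳ-<-pos B {{positive 0<B}} b<e ⟩
      B * e          ∎

    product-gap : ∀ B e ε a b c d → 0ℚ < B → B * e ≡ ε * ½ → ∣ a ∣ < B → ∣ d ∣ < B →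
                  ∣ a - c ∣ < e → ∣ b - d ∣ < e → ∣ a * b - c * d ∣ < ε
    product-gap B e ε a b c d 0<B Be a<B d<B ac bd = begin-strict
      ∣ a * b - c * d ∣                    ≡⟨ cong ∣_∣ (rearrange a b c d) ⟩
      ∣ a * (b - d) + d * (a - c) ∣        ≤⟨ ∣p+q∣≤∣p∣+∣q∣ (a * (b - d)) (d * (a - c)) ⟩
      ∣ a * (b - d) ∣ + ∣ d * (a - c) ∣
        <⟨ +-mono-< (*-mono-abs a (b - d) 0<B a<B bd) (*-mono-abs d (a - c) 0<B d<B ac) ⟩
      B * e + B * e                        ≡⟨ cong₂ _+_ Be Be ⟩
      ε * ½ + ε * ½                        ≡⟨ halves ε ⟩
      ε                                    ∎
      where
      rearrange : ∀ a b c d → a * b - c * d ≡ a * (b - d) + d * (a - c)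
      rearrange = solve 4 (λ a b c d → a :* b :- c :* d := a :* (b :- d) :+ d :* (a :- c)) refl

    p<p+q : ∀ p q → 0ℚ < q → p < p + q
    p<p+q p q 0<q = subst (_< p + q) (+-identityʳ p) (+-monoʳ-< p 0<q)

    p<q+p : ∀ p q → 0ℚ < q → p < q + p
    p<q+p p q 0<q = subst (_< q + p) (+-identityˡ p) (+-monoˡ-< p 0<q)

    times-cauchy : ∀ x y → IsCauchy (λ n → seq x n * seq y n)
    times-cauchy x y ε 0<ε = from-bounds (eventually-bounded x) (eventually-bounded y)
      where
      from-bounds : (∃ λ N → ∃ λ B → 0ℚ < B × (∀ n → N ℕ.≤ n → ∣ seq x n ∣ < B)) →
                    (∃ λ N → ∃ λ B → 0ℚ < B × (∀ n → N ℕ.≤ n → ∣ seq y n ∣ < B)) →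
                    ∃ λ N → ∀ m n → N ℕ.≤ m → N ℕ.≤ n →
                      ∣ seq x m * seq y m - seq x n * seq y n ∣ < ε
      from-bounds (M₁ , A , 0<A , boundˣ) (N₁ , C , 0<C , boundʸ) =
        from-rescaling (rescale (A + C) (ε * ½) 0<B (half-pos 0<ε))
        where
        0<B : 0ℚ < A + C
        0<B = <-trans 0<A (p<p+q A C 0<C)
        from-rescaling : (∃ λ e → 0ℚ < e × (A + C) * e ≡ ε * ½) →
                         ∃ λ N → ∀ m n → N ℕ.≤ m → N ℕ.≤ n →
                           ∣ seq x m * seq y m - seq x n * seq y n ∣ < ε
        from-rescaling (e , 0<e , Be)
          with (M₂ , closeˣ) ← cauchy x e 0<e
             | (N₂ , closeʸ) ← cauchy y e 0<e
          = (M₁ ℕ.⊔ N₁) ℕ.⊔ (M₂ ℕ.⊔ N₂) , λ m n m≥ n≥ →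
            product-gap (A + C) e ε (seq x m) (seq y m) (seq x n) (seq y n) 0<B Be
              (<-trans (boundˣ m (ℕ.m⊔n≤o⇒m≤o M₁ N₁ (bounds m≥))) (p<p+q A C 0<C))
              (<-trans (boundʸ n (ℕ.m⊔n≤o⇒n≤o M₁ N₁ (bounds n≥))) (p<q+p C A 0<A))
              (closeˣ m n (ℕ.m⊔n≤o⇒m≤o M₂ N₂ (closes m≥)) (ℕ.m⊔n≤o⇒m≤o M₂ N₂ (closes n≥)))
              (closeʸ m n (ℕ.m⊔n≤o⇒n≤o M₂ N₂ (closes m≥)) (ℕ.m⊔n≤o⇒n≤o M₂ N₂ (closes n≥)))
          where
          bounds : ∀ {m} → (M₁ ℕ.⊔ N₁) ℕ.⊔ (M₂ ℕ.⊔ N₂) ℕ.≤ m → M₁ ℕ.⊔ N₁ ℕ.≤ m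
          bounds = ℕ.m⊔n≤o⇒m≤o (M₁ ℕ.⊔ N₁) (M₂ ℕ.⊔ N₂)
          closes : ∀ {m} → (M₁ ℕ.⊔ N₁) ℕ.⊔ (M₂ ℕ.⊔ N₂) ℕ.≤ m → M₂ ℕ.⊔ N₂ ℕ.≤ m
          closes = ℕ.m⊔n≤o⇒n≤o (M₁ ℕ.⊔ N₁) (M₂ ℕ.⊔ N₂)

  infixl 6 _-ᵣ_
  infixl 7 _*ᵣ_
  infixr 8 _^ᵣ_

  _-ᵣ_ : ℝ → ℝ → ℝ
  x -ᵣ y = mkℝ (λ n → seq x n - seq y n) (minus-cauchy x y)

  _*ᵣ_ : ℝ → ℝ → ℝ
  x *ᵣ y = mkℝ (λ n → seq x n * seq y n) (times-cauchy x y)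

  _^ᵣ_ : ℝ → ℕ → ℝ
  x ^ᵣ zero  = fromℚ 1ℚ
  x ^ᵣ suc d = x *ᵣ x ^ᵣ d

  -- Bisection for the d-th root of q, starting from the interval [0 , 1 ⊔ q]:
  -- after n steps the root lies in [lower n , lower n + width n].
  module Bisection (d : ℕ) (q : ℚ) where

    width : ℕ → ℚ
    width zero    = 1ℚ ⊔ q
    width (suc n) = width n * ½

    lower : ℕ → ℚ
    lower zero = 0ℚ
    lower (suc n) with (lower n + width (suc n)) ^ d ≤? q
    ... | yes _ = lower n + width (suc n)
    ... | no  _ = lower n

    private
      width>0 : ∀ n → 0ℚ < width n
      width>0 zero    = <-≤-trans (positive⁻¹ 1ℚ) (p≤p⊔q 1ℚ q)
      width>0 (suc n) = half-pos (width>0 n)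

      grow : ∀ n → lower n ≤ lower (suc n)
      grow n with (lower n + width (suc n)) ^ d ≤? q
      ... | yes _ = subst (_≤ lower n + width (suc n)) (+-identityʳ (lower n))
                      (+-monoʳ-≤ (lower n) (<⇒≤ (width>0 (suc n))))
      ... | no  _ = ≤-refl

      shrink : ∀ n → lower (suc n) + width (suc n) ≤ lower n + width n
      shrink n with (lower n + width (suc n)) ^ d ≤? q
      ... | yes _ = ≤-reflexive (trans (+-assoc (lower n) (width (suc n)) (width (suc n)))
                      (cong (λ w → lower n + w) (halves (width n))))
      ... | no  _ = +-monoʳ-≤ (lower n) (begin
        width (suc n)                    ≡⟨ +-identityʳ (width (suc n)) ⟨
        width (suc n) + 0ℚ               ≤⟨ +-monoʳ-≤ (width (suc n)) (<⇒≤ (width>0 (suc n))) ⟩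
        width (suc n) + width (suc n)    ≡⟨ halves (width n) ⟩
        width n                          ∎)

      lower-mono : ∀ {m n} → m ℕ.≤′ n → lower m ≤ lower n
      lower-mono (ℕ.≤′-reflexive refl) = ≤-refl
      lower-mono (ℕ.≤′-step {n = n} m≤n) = ≤-trans (lower-mono m≤n) (grow n)

      upper-anti : ∀ {m n} → m ℕ.≤′ n → lower n + width n ≤ lower m + width m
      upper-anti (ℕ.≤′-reflexive refl) = ≤-refl
      upper-anti (ℕ.≤′-step {n = n} m≤n) = ≤-trans (shrink n) (upper-anti m≤n)

      lower≤upper : ∀ n → lower n ≤ lower n + width n
      lower≤upper n = <⇒≤ (p<p+q (lower n) (width n) (width>0 n))

      ι : ℕ → ℚ
      ι zero    = 0ℚ
      ι (suc n) = 1ℚ + ι n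

      0≤ι : ∀ n → 0ℚ ≤ ι n
      0≤ι zero    = ≤-refl
      0≤ι (suc n) = +-mono-≤ (<⇒≤ (positive⁻¹ 1ℚ)) (0≤ι n)

      toℚᵘ-ι : ∀ n → toℚᵘ (ι n) ℚᵘ.≃ ℚᵘ.mkℚᵘ (+ n) 0
      toℚᵘ-ι zero    = ℚᵘ.≃-refl
      toℚᵘ-ι (suc n) = ℚᵘ.≃-trans (toℚᵘ-homo-+ 1ℚ (ι n))
        (ℚᵘ.≃-trans (ℚᵘ.+-congʳ ℚᵘ.1ℚᵘ (toℚᵘ-ι n))
        (ℚᵘ.*≡* (cong (λ z → (+ 1 ℤ.+ z) ℤ.* + 1) (ℤ.*-identityʳ (+ n)))))

      archimedean : ∀ p → ∃ λ n → p ≤ ι n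
      archimedean p = ℤ.∣ ↥ p ∣ , toℚᵘ-cancel-≤
        (ℚᵘ.≤-trans (bound p) (ℚᵘ.≤-reflexive (ℚᵘ.≃-sym (toℚᵘ-ι ℤ.∣ ↥ p ∣))))
        where
        bound : ∀ p → toℚᵘ p ℚᵘ.≤ ℚᵘ.mkℚᵘ (+ ℤ.∣ ↥ p ∣) 0
        bound (mkℚ (+ n) d _)    = ℚᵘ.*≤* (ℤ.*-monoˡ-≤-nonNeg (+ n) (ℤ.+≤+ (ℕ.s≤s ℕ.z≤n)))
        bound (mkℚ -[1+ n ] d _) = ℚᵘ.*≤* ℤ.-≤+

      width-decay : ∀ n → width n * ι (suc n) ≤ width 0
      width-decay zero    = ≤-reflexive (trans (cong (width 0 *_) (+-identityʳ 1ℚ)) (*-identityʳ (width 0)))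
      width-decay (suc n) = begin
        w * ½ * (1ℚ + (1ℚ + ι n))              ≤⟨ *-monoˡ-≤-nonNeg (w * ½) {{nonNegative (<⇒≤ (half-pos (width>0 n)))}} grows ⟩
        w * ½ * ((1ℚ + ι n) + (1ℚ + ι n))      ≡⟨ rearrange w (1ℚ + ι n) ⟩
        w * (1ℚ + ι n)                         ≤⟨ width-decay n ⟩
        width 0                                ∎
        where
        w : ℚ
        w = width n
        grows : 1ℚ + (1ℚ + ι n) ≤ (1ℚ + ι n) + (1ℚ + ι n)
        grows = +-monoˡ-≤ (1ℚ + ι n) (subst (_≤ 1ℚ + ι n) (+-identityʳ 1ℚ) (+-monoʳ-≤ 1ℚ (0≤ι n)))
        rearrange : ∀ a b → a * ½ * (b + b) ≡ a * b
        rearrange = solve 2 (λ a b → a :* con ½ :* (b :+ b) := a :* b) refl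

      width-small : ∀ ε → 0ℚ < ε → ∃ λ n → width n < ε
      width-small ε 0<ε with (n , p≤n) ← archimedean (width 0 * (1/ ε) {{pos⇒nonZero ε {{positive 0<ε}}}}) =
        n , *-cancelʳ-<-nonNeg (1ℚ + ι n) {{nonNegative (0≤ι (suc n))}} (begin-strict
          width n * (1ℚ + ι n)     ≤⟨ width-decay n ⟩
          width 0                  ≡⟨ *-identityʳ (width 0) ⟨
          width 0 * 1ℚ             ≡⟨ cong (width 0 *_) (*-inverseˡ ε) ⟨
          width 0 * (1/ ε * ε)     ≡⟨ *-assoc (width 0) (1/ ε) ε ⟨
          width 0 * 1/ ε * ε       ≤⟨ *-monoʳ-≤-nonNeg ε {{pos⇒nonNeg ε}} p≤n ⟩
          ι n * ε                  ≡⟨ *-comm (ι n) ε ⟩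
          ε * ι n                  <⟨ *-monoʳ-<-pos ε (subst (_< 1ℚ + ι n) (+-identityˡ (ι n)) (+-monoˡ-< (ι n) (positive⁻¹ 1ℚ))) ⟩
          ε * (1ℚ + ι n)           ∎)
        where
        instance
          ε-pos : Positive ε
          ε-pos = positive 0<ε
          ε-nonZero : NonZero ε
          ε-nonZero = pos⇒nonZero ε

      width-anti : ∀ {m n} → m ℕ.≤′ n → width n ≤ width m
      width-anti (ℕ.≤′-reflexive refl) = ≤-refl
      width-anti (ℕ.≤′-step {n = n} m≤n) = ≤-trans halving (width-anti m≤n)
        where
        halving : width n * ½ ≤ width n
        halving = subst (width n * ½ ≤_) (halves (width n))
          (subst (_≤ width n * ½ + width n * ½) (+-identityʳ (width n * ½))
            (+-monoʳ-≤ (width n * ½) (<⇒≤ (width>0 (suc n)))))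

      within : ∀ {l w} → ∀ a b → l ≤ a → a ≤ l + w → l ≤ b → b ≤ l + w → ∣ a - b ∣ ≤ w
      within {l} {w} a b l≤a a≤ l≤b b≤ with ∣p∣≡p∨∣p∣≡-p (a - b)
      ... | inj₁ eq = subst (_≤ w) (sym eq) (gap a b a≤ l≤b)
        where
        gap : ∀ a b → a ≤ l + w → l ≤ b → a - b ≤ w
        gap a b a≤ l≤b = begin
          a - b        ≤⟨ +-mono-≤ a≤ (neg-antimono-≤ l≤b) ⟩
          l + w - l    ≡⟨ solve 2 (λ l w → l :+ w :- l := w) refl l w ⟩
          w            ∎
      ... | inj₂ eq = subst (_≤ w) (trans (flip a b) (sym eq)) (gap b≤ l≤a)
        where
        flip : ∀ a b → b - a ≡ - (a - b)
        flip = solve 2 (λ a b → b :- a := :- (a :- b)) refl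
        gap : b ≤ l + w → l ≤ a → b - a ≤ w
        gap b≤ l≤a = begin
          b - a        ≤⟨ +-mono-≤ b≤ (neg-antimono-≤ l≤a) ⟩
          l + w - l    ≡⟨ solve 2 (λ l w → l :+ w :- l := w) refl l w ⟩
          w            ∎

    lower-cauchy : IsCauchy lower
    lower-cauchy ε 0<ε with (N , small) ← width-small ε 0<ε =
      N , λ m n m≥ n≥ → ≤-<-trans
        (within (lower m) (lower n)
          (lower-mono (ℕ.≤⇒≤′ m≥)) (≤-trans (lower≤upper m) (upper-anti (ℕ.≤⇒≤′ m≥)))
          (lower-mono (ℕ.≤⇒≤′ n≥)) (≤-trans (lower≤upper n) (upper-anti (ℕ.≤⇒≤′ n≥))))
        small

    private
      W : ℚ
      W = width 0

      0≤W : 0ℚ ≤ W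
      0≤W = <⇒≤ (width>0 0)

      *-mono-≤-nonNeg : ∀ {a b c e} → 0ℚ ≤ a → 0ℚ ≤ e → a ≤ b → c ≤ e → a * c ≤ b * e
      *-mono-≤-nonNeg {a} {b} {c} {e} 0≤a 0≤e a≤b c≤e =
        ≤-trans (*-monoˡ-≤-nonNeg a {{nonNegative 0≤a}} c≤e)
                (*-monoʳ-≤-nonNeg e {{nonNegative 0≤e}} a≤b)

      *-nonNeg : ∀ {a b} → 0ℚ ≤ a → 0ℚ ≤ b → 0ℚ ≤ a * b
      *-nonNeg {a} {b} 0≤a 0≤b = subst (_≤ a * b) (*-zeroʳ a) (*-monoˡ-≤-nonNeg a {{nonNegative 0≤a}} 0≤b)

      1≤W^ : ∀ e → 1ℚ ≤ W ^ e
      1≤W^ zero    = ≤-refl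
      1≤W^ (suc e) = subst (_≤ W * W ^ e) (*-identityˡ 1ℚ)
        (*-mono-≤-nonNeg (<⇒≤ (positive⁻¹ 1ℚ)) (≤-trans (<⇒≤ (positive⁻¹ 1ℚ)) (1≤W^ e)) (p≤p⊔q 1ℚ q) (1≤W^ e))

      q≤W^ : ∀ e → q ≤ W ^ suc e
      q≤W^ e = ≤-trans (p≤q⊔p 1ℚ q) (subst (_≤ W * W ^ e) (*-identityʳ W)
        (*-monoˡ-≤-nonNeg W {{nonNegative 0≤W}} (1≤W^ e)))

    0≤lower : ∀ n → 0ℚ ≤ lower n
    0≤lower n = lower-mono {0} {n} (ℕ.≤⇒≤′ ℕ.z≤n)

    lower^≤q : .{{ℕ.NonZero d}} → 0ℚ ≤ q → ∀ n → lower n ^ d ≤ q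
    lower^≤q 0≤q zero = subst (_≤ q) (sym (0^ d)) 0≤q
      where
      0^ : ∀ e → .{{ℕ.NonZero e}} → 0ℚ ^ e ≡ 0ℚ
      0^ (suc e) = *-zeroˡ (0ℚ ^ e)
    lower^≤q 0≤q (suc n) with (lower n + width (suc n)) ^ d ≤? q
    ... | yes ≤q = ≤q
    ... | no  _  = lower^≤q 0≤q n

    q≤upper^ : .{{ℕ.NonZero d}} → ∀ n → q ≤ (lower n + width n) ^ d
    q≤upper^ zero = subst (λ w → q ≤ w ^ d) (sym (+-identityˡ W)) (base d)
      where
      base : ∀ e → .{{ℕ.NonZero e}} → q ≤ W ^ e
      base (suc e) = q≤W^ e
    q≤upper^ (suc n) with (lower n + width (suc n)) ^ d ≤? q
    ... | yes _ = subst (λ w → q ≤ w ^ d) (sym (trans (+-assoc (lower n) (width (suc n)) (width (suc n)))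
                    (cong (λ w → lower n + w) (halves (width n))))) (q≤upper^ n)
    ... | no ≰q = <⇒≤ (≰⇒> ≰q)

    private
      power-gap : ∀ e → ∃ λ C → ∃ λ D → 0ℚ < C × (∀ n →
                  0ℚ ≤ lower n ^ e × lower n ^ e ≤ D × (lower n + width n) ^ e ≤ lower n ^ e + C * width n)
      power-gap zero = 1ℚ , 1ℚ , positive⁻¹ 1ℚ , λ n → <⇒≤ (positive⁻¹ 1ℚ) , ≤-refl ,
        subst (λ w → 1ℚ ≤ 1ℚ + w) (sym (*-identityˡ (width n))) (<⇒≤ (p<p+q 1ℚ (width n) (width>0 n)))
      power-gap (suc e) with (C , D , 0<C , bounds) ← power-gap e =
        D + W * C , W * D , 0<C′ , λ n → bound n (bounds n)
        where
        0≤D : 0ℚ ≤ D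
        0≤D = ≤-trans (proj₁ (bounds 0)) (proj₁ (proj₂ (bounds 0)))
        0<C′ : 0ℚ < D + W * C
        0<C′ = +-mono-≤-< {0ℚ} {D} {0ℚ} {W * C} 0≤D
          (subst (_< W * C) (*-zeroʳ W) (*-monoʳ-<-pos W {{positive (width>0 0)}} 0<C))
        bound : ∀ n →
          0ℚ ≤ lower n ^ e × lower n ^ e ≤ D × (lower n + width n) ^ e ≤ lower n ^ e + C * width n →
          0ℚ ≤ lower n ^ suc e × lower n ^ suc e ≤ W * D ×
          (lower n + width n) ^ suc e ≤ lower n ^ suc e + (D + W * C) * width n
        bound n (0≤p , p≤D , gap) = *-nonNeg (0≤lower n) 0≤p , *-mono-≤-nonNeg (0≤lower n) 0≤D l≤W p≤D , (begin
          (l + w) * (l + w) ^ e             ≤⟨ *-monoˡ-≤-nonNeg (l + w) {{nonNegative 0≤l+w}} gap ⟩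
          (l + w) * (p + C * w)             ≡⟨ expand l w p C ⟩
          l * p + (p + (l + w) * C) * w
            ≤⟨ +-monoʳ-≤ (l * p) (*-monoʳ-≤-nonNeg w {{nonNegative (<⇒≤ (width>0 n))}}
                 (+-mono-≤ p≤D (*-monoʳ-≤-nonNeg C {{nonNegative (<⇒≤ 0<C)}} l+w≤W))) ⟩
          l * p + (D + W * C) * w           ∎)
          where
          l w p : ℚ
          l = lower n
          w = width n
          p = lower n ^ e
          0≤l+w : 0ℚ ≤ l + w
          0≤l+w = ≤-trans (0≤lower n) (lower≤upper n)
          l+w≤W : l + w ≤ W
          l+w≤W = subst (l + w ≤_) (+-identityˡ W) (upper-anti {0} {n} (ℕ.≤⇒≤′ ℕ.z≤n))
          l≤W : l ≤ W
          l≤W = ≤-trans (lower≤upper n) l+w≤W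
          expand : ∀ l w p C → (l + w) * (p + C * w) ≡ l * p + (p + (l + w) * C) * w
          expand = solve 4 (λ l w p C → (l :+ w) :* (p :+ C :* w) := l :* p :+ (p :+ (l :+ w) :* C) :* w) refl

    lower^-close : .{{ℕ.NonZero d}} → ∀ ε → 0ℚ < ε →
                   ∃ λ N → ∀ n → N ℕ.≤ n → q ≤ lower n ^ d + ε
    lower^-close ε 0<ε
      with (C , D , 0<C , bounds) ← power-gap d
      with (e , 0<e , Ce) ← rescale C ε 0<C 0<ε
      with (N , small) ← width-small e 0<e
      = N , λ n n≥ → begin
        q                              ≤⟨ q≤upper^ n ⟩
        (lower n + width n) ^ d        ≤⟨ proj₂ (proj₂ (bounds n)) ⟩
        lower n ^ d + C * width n
          ≤⟨ +-monoʳ-≤ (lower n ^ d) (*-monoˡ-≤-nonNeg C {{nonNegative (<⇒≤ 0<C)}}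
               (≤-trans (width-anti (ℕ.≤⇒≤′ n≥)) (<⇒≤ small))) ⟩
        lower n ^ d + C * e            ≡⟨ cong (λ z → lower n ^ d + z) Ce ⟩
        lower n ^ d + ε                ∎

  -- root d q is q ^ (1 / d), for 1 ≤ d and 0 ≤ q: see root-nonNeg and root-^.
  root : ℕ → ℚ → ℝ
  root d q = mkℝ (Bisection.lower d q) (Bisection.lower-cauchy d q)

  seq-^ : ∀ x d n → seq (x ^ᵣ d) n ≡ seq x n ^ d
  seq-^ x zero    n = refl
  seq-^ x (suc d) n = cong (seq x n *_) (seq-^ x d n)

  root-nonNeg : ∀ d q → fromℚ 0ℚ ≤ᵣ root d q
  root-nonNeg d q ε 0<ε = 0 , λ n _ →
    ≤-trans (Bisection.0≤lower d q n) (<⇒≤ (p<p+q (Bisection.lower d q n) ε 0<ε))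

  root-^ : ∀ d q → .{{ℕ.NonZero d}} → 0ℚ ≤ q → root d q ^ᵣ d ≃ᵣ fromℚ q
  root-^ d q 0≤q = below , above
    where
    below : root d q ^ᵣ d ≤ᵣ fromℚ q
    below ε 0<ε = 0 , λ n _ → subst (_≤ q + ε) (sym (seq-^ (root d q) d n))
      (≤-trans (Bisection.lower^≤q d q 0≤q n) (<⇒≤ (p<p+q q ε 0<ε)))
    above : fromℚ q ≤ᵣ root d q ^ᵣ d
    above ε 0<ε with (N , close) ← Bisection.lower^-close d q ε 0<ε =
      N , λ n n≥ → subst (λ p → q ≤ p + ε) (sym (seq-^ (root d q) d n)) (close n n≥)

open Reals public using
  ( ℝ; mkℝ; seq; cauchy; IsCauchy; _≤ᵣ_; _≃ᵣ_; fromℚ; fromℕ; _-ᵣ_; _*ᵣ_; _^ᵣ_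
  ; module Bisection; root; seq-^; root-nonNeg; root-^ )

module Graphs where

  open import Data.Fin.Base using (Fin)
  open import Data.Fin.Properties using (all?; any?)
  open import Data.Fin.Subset using (Subset; _∈_; _∉_; ∣_∣; ⊤)
  open import Data.Fin.Subset.Properties using (_∈?_; anySubset?; ∈⊤)
  open import Data.Nat.Base using (zero; suc; _≤_; _<_; s≤s⁻¹)
  open import Data.Nat.Properties using (_<?_; ≮⇒≥; ≤-refl; ≤-trans)
  open import Data.Product.Base using (_×_; _,_; proj₁; proj₂; ∃)
  open import Data.Vec.Base using (tabulate)
  open import Level using (0ℓ)
  open import Relation.Binary.Core using (Rel)
  open import Relation.Binary.Definitions using (Decidable; Symmetric)
  open import Relation.Binary.PropositionalEquality using (_≡_; refl)
  open import Relation.Nullary.Decidable using (Dec; does; yes; no; ¬?; _×-dec_; _→-dec_)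
  open import Relation.Nullary.Negation using (¬_; contradiction)

  record Graph (n : ℕ) : Set₁ where
    field
      Adj    : Rel (Fin n) 0ℓ
      adj?   : Decidable Adj
      symm   : Symmetric Adj
      irrefl : ∀ {v} → ¬ Adj v v

    neighbours : Fin n → Subset n
    neighbours v = tabulate λ u → does (adj? v u)

    degree : Fin n → ℕ
    degree v = ∣ neighbours v ∣

  open Graph public

  MinDegree≥ : ∀ {n} → ℕ → Graph n → Set
  MinDegree≥ δ G = ∀ v → δ ≤ degree G v

  module _ {k n : ℕ} (F : Fin k → Graph n) where

    SimDominating : Subset n → Set
    SimDominating S = ∀ i v → v ∉ S → ∃ λ u → u ∈ S × Adj (F i) v u

    IsSimDomNumber : ℕ → Set
    IsSimDomNumber γ = (∃ λ S → SimDominating S × ∣ S ∣ ≡ γ) × (∀ S → SimDominating S → γ ≤ ∣ S ∣)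

    simDominating? : ∀ S → Dec (SimDominating S)
    simDominating? S = all? λ i → all? λ v →
      ¬? (v ∈? S) →-dec any? λ u → (u ∈? S) ×-dec adj? (F i) v u

    private
      minimise : ∀ fuel S → SimDominating S → ∣ S ∣ < fuel → ∃ IsSimDomNumber
      minimise (suc fuel) S dom <fuel with anySubset? (λ T → simDominating? T ×-dec (∣ T ∣ <? ∣ S ∣))
      ... | yes (T , domT , T<S) = minimise fuel T domT (≤-trans T<S (s≤s⁻¹ <fuel))
      ... | no none = ∣ S ∣ , (S , dom , refl) , λ T domT → ≮⇒≥ λ T<S → none (T , domT , T<S)

    simDomNumber : ∃ IsSimDomNumber
    simDomNumber = minimise (suc ∣ ⊤ {n} ∣) ⊤ (λ i v v∉⊤ → contradiction ∈⊤ v∉⊤) ≤-refl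

    γsd : ℕ
    γsd = proj₁ simDomNumber

open Graphs public

k[1+δ]≢0 : ∀ {k} δ → 2 Nat.≤ k → Nat.NonZero (k Nat.* ℕ.suc δ)
k[1+δ]≢0 δ (Nat.s≤s _) = _

{-# OPTIONS --safe #-}
-- Put every vertex into a random set S independently with probability 1 - x,
-- and let D consist of S and of the vertices whose closed neighbourhood in some
-- factor misses S.  Then D is simultaneously dominating, and a vertex lies in D
-- with probability at most (1 - x) + k x ^ (δ + 1), hence some D has at most
-- ((1 - x) + k x ^ (δ + 1)) n elements.  If x ^ δ ≤ 1 / (k (δ + 1)), this is at
-- most (1 - δ / (δ + 1) x) n.  All lower approximations of the root produced by
-- the bisection satisfy this inequality, so no limit has to be taken.
module Submission where

open import Defs

-- Rational arithmetic: naturals as rationals, powers, and the estimate in `x`.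

module Rational where

  import Algebra.Definitions.RawSemiring
  open import Data.Integer.Base as ℤ using (+_)
  import Data.Integer.Properties as ℤ
  open import Data.Nat.Base as ℕ using (ℕ; zero; suc)
  import Data.Nat.Properties as ℕ
  open import Data.Rational.Base
  open import Data.Rational.Properties
  open import Data.Rational.Solver using (module +-*-Solver)
  import Data.Rational.Unnormalised.Base as ℚᵘ
  import Data.Rational.Unnormalised.Properties as ℚᵘ
  open import Relation.Binary.PropositionalEquality
    using (_≡_; refl; sym; cong; cong₂; subst)
  open import Relation.Nullary.Decidable using (yes; no)
  open import Relation.Nullary.Negation using (contradiction)

  open +-*-Solver using (solve; _:=_; _:+_; _:*_; _:-_; con)
  open ≤-Reasoning
  open Algebra.Definitions.RawSemiring +-*-rawSemiring public using (_^_)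

  ι : ℕ → ℚ
  ι n = + n / 1

  0≤1 : 0ℚ ≤ 1ℚ
  0≤1 = <⇒≤ (positive⁻¹ 1ℚ)

  -- `_/_` divides out a gcd and so does not compute on open terms. This equivalence moves claims
  -- about `ι` and `_/_` to unnormalised fractions, where they become statements about cross
  -- products of integers.
  toℚᵘ-/ : ∀ m d → toℚᵘ (+ m / suc d) ℚᵘ.≃ ℚᵘ.mkℚᵘ (+ m) d
  toℚᵘ-/ m d = toℚᵘ-fromℚᵘ (ℚᵘ.mkℚᵘ (+ m) d)

  ι-+ : ∀ m n → ι (m ℕ.+ n) ≡ ι m + ι n
  ι-+ m n = toℚᵘ-injective (ℚᵘ.≃-trans (toℚᵘ-/ (m ℕ.+ n) 0) (ℚᵘ.≃-trans
    (ℚᵘ.*≡* (cong (ℤ._* + 1) (cong₂ ℤ._+_ (sym (ℤ.*-identityʳ (+ m))) (sym (ℤ.*-identityʳ (+ n))))))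
    (ℚᵘ.≃-sym (ℚᵘ.≃-trans (toℚᵘ-homo-+ (ι m) (ι n)) (ℚᵘ.+-cong (toℚᵘ-/ m 0) (toℚᵘ-/ n 0))))))

  ι-* : ∀ m n → ι (m ℕ.* n) ≡ ι m * ι n
  ι-* zero    n = sym (*-zeroˡ (ι n))
  ι-* (suc m) n = begin-equality
    ι (n ℕ.+ m ℕ.* n)      ≡⟨ ι-+ n (m ℕ.* n) ⟩
    ι n + ι (m ℕ.* n)      ≡⟨ cong (λ z → ι n + z) (ι-* m n) ⟩
    ι n + ι m * ι n        ≡⟨ solve 2 (λ m n → n :+ m :* n := (con 1ℚ :+ m) :* n) refl (ι m) (ι n) ⟩
    (1ℚ + ι m) * ι n       ≡⟨ cong (_* ι n) (ι-+ 1 m) ⟨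
    ι (suc m) * ι n        ∎

  ι-mono : ∀ {m n} → m ℕ.≤ n → ι m ≤ ι n
  ι-mono {m} {n} m≤n = toℚᵘ-cancel-≤
    (ℚᵘ.≤-respˡ-≃ (ℚᵘ.≃-sym (toℚᵘ-/ m 0))
    (ℚᵘ.≤-respʳ-≃ (ℚᵘ.≃-sym (toℚᵘ-/ n 0))
    (ℚᵘ.*≤* (ℤ.*-monoʳ-≤-nonNeg (+ 1) (ℤ.+≤+ m≤n)))))

  0≤ι : ∀ n → 0ℚ ≤ ι n
  0≤ι n = ι-mono {0} {n} ℕ.z≤n

  ι-pos : ∀ n .{{_ : ℕ.NonZero n}} → Positive (ι n)
  ι-pos n = positive (<-≤-trans (positive⁻¹ 1ℚ) (ι-mono (ℕ.>-nonZero⁻¹ n)))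

  /-*-cancel : ∀ m d .{{_ : ℕ.NonZero d}} → (+ m / d) * ι d ≡ ι m
  /-*-cancel m (suc d) = toℚᵘ-injective (ℚᵘ.≃-trans (toℚᵘ-homo-* (+ m / suc d) (ι (suc d))) (ℚᵘ.≃-trans
    (ℚᵘ.*-cong (toℚᵘ-/ m d) (toℚᵘ-/ (suc d) 0))
    (ℚᵘ.≃-trans (ℚᵘ.*≡* (ℤ.*-assoc (+ m) (+ suc d) (+ 1)))
      (ℚᵘ.≃-sym (toℚᵘ-/ m 0)))))

  ^-nonNeg : ∀ {x} d → 0ℚ ≤ x → 0ℚ ≤ x ^ d
  ^-nonNeg zero    0≤x = 0≤1
  ^-nonNeg {x} (suc d) 0≤x =
    subst (_≤ x * x ^ d) (*-zeroʳ x) (*-monoˡ-≤-nonNeg x {{nonNegative 0≤x}} (^-nonNeg d 0≤x))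

  ^-≤1 : ∀ {x} d → 0ℚ ≤ x → x ≤ 1ℚ → x ^ d ≤ 1ℚ
  ^-≤1 zero    0≤x x≤1 = ≤-refl
  ^-≤1 {x} (suc d) 0≤x x≤1 = begin
    x * x ^ d    ≤⟨ *-monoˡ-≤-nonNeg x {{nonNegative 0≤x}} (^-≤1 d 0≤x x≤1) ⟩
    x * 1ℚ       ≡⟨ *-identityʳ x ⟩
    x            ≤⟨ x≤1 ⟩
    1ℚ           ∎

  ^-anti : ∀ {x d e} → 0ℚ ≤ x → x ≤ 1ℚ → d ℕ.≤ e → x ^ e ≤ x ^ d
  ^-anti {e = e} 0≤x x≤1 ℕ.z≤n = ^-≤1 e 0≤x x≤1
  ^-anti {x} 0≤x x≤1 (ℕ.s≤s d≤e) = *-monoˡ-≤-nonNeg x {{nonNegative 0≤x}} (^-anti 0≤x x≤1 d≤e)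

  1≤^ : ∀ {x} d → 1ℚ ≤ x → 1ℚ ≤ x ^ d
  1≤^ zero    1≤x = ≤-refl
  1≤^ {x} (suc d) 1≤x = begin
    1ℚ           ≤⟨ 1≤x ⟩
    x            ≡⟨ *-identityʳ x ⟨
    x * 1ℚ       ≤⟨ *-monoˡ-≤-nonNeg x {{nonNegative (≤-trans 0≤1 1≤x)}} (1≤^ d 1≤x) ⟩
    x * x ^ d    ∎

  -- If `x` exceeded 1, then `x ^ d` would be at least `x`, hence above 1. This is what makes `x` a
  -- probability once its power is bounded.
  ^-≤1⁻¹ : ∀ {x} d .{{_ : ℕ.NonZero d}} → x ^ d ≤ 1ℚ → x ≤ 1ℚ
  ^-≤1⁻¹ {x} (suc d) x^≤1 with x ≤? 1ℚ
  ... | yes x≤1 = x≤1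
  ... | no  x≰1 = contradiction (<-≤-trans 1<x (begin
    x            ≡⟨ *-identityʳ x ⟨
    x * 1ℚ       ≤⟨ *-monoˡ-≤-nonNeg x {{nonNegative (≤-trans 0≤1 (<⇒≤ 1<x))}} (1≤^ d (<⇒≤ 1<x)) ⟩
    x * x ^ d    ≤⟨ x^≤1 ⟩
    1ℚ           ∎)) (<-irrefl refl)
    where
    1<x : 1ℚ < x
    1<x = ≰⇒> x≰1

  1/n≤1 : ∀ n .{{_ : ℕ.NonZero n}} → + 1 / n ≤ 1ℚ
  1/n≤1 n = *-cancelʳ-≤-pos (ι n) {{ι-pos n}} (begin
    + 1 / n * ι n    ≡⟨ /-*-cancel 1 n ⟩
    ι 1              ≤⟨ ι-mono (ℕ.>-nonZero⁻¹ n) ⟩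
    ι n              ≡⟨ *-identityˡ (ι n) ⟨
    1ℚ * ι n         ∎)

  0≤1/n : ∀ n .{{_ : ℕ.NonZero n}} → 0ℚ ≤ + 1 / n
  0≤1/n n = *-cancelʳ-≤-pos (ι n) {{ι-pos n}} (begin
    0ℚ * ι n         ≡⟨ *-zeroˡ (ι n) ⟩
    0ℚ               ≤⟨ 0≤1 ⟩
    1ℚ               ≡⟨ /-*-cancel 1 n ⟨
    + 1 / n * ι n    ∎)

  p≤q⇒p≤q+ε : ∀ {p q ε} → 0ℚ < ε → p ≤ q → p ≤ q + ε
  p≤q⇒p≤q+ε {p} {q} {ε} 0<ε p≤q = subst (_≤ q + ε) (+-identityʳ p) (+-mono-≤ p≤q (<⇒≤ 0<ε))

  -- Both sides are 1 / (δ + 1): multiplied by `ι (suc δ)`, each becomes 1.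
  k/k[1+δ]≤1-δ/[1+δ] : ∀ k δ .{{_ : ℕ.NonZero (k ℕ.* suc δ)}} →
                       ι k * (+ 1 / (k ℕ.* suc δ)) ≤ 1ℚ - + δ / suc δ
  k/k[1+δ]≤1-δ/[1+δ] k δ = *-cancelʳ-≤-pos (ι (suc δ)) {{ι-pos (suc δ)}} (≤-reflexive (begin-equality
    ι k * q * ι (suc δ)
      ≡⟨ solve 3 (λ a b c → a :* b :* c := b :* (a :* c)) refl (ι k) q (ι (suc δ)) ⟩
    q * (ι k * ι (suc δ))             ≡⟨ cong (q *_) (ι-* k (suc δ)) ⟨
    q * ι (k ℕ.* suc δ)               ≡⟨ /-*-cancel 1 (k ℕ.* suc δ) ⟩
    1ℚ                                ≡⟨ solve 1 (λ d → con 1ℚ := con 1ℚ :+ d :- d) refl (ι δ) ⟩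
    1ℚ + ι δ - ι δ                    ≡⟨ cong₂ _-_ (sym (ι-+ 1 δ)) (sym (/-*-cancel δ (suc δ))) ⟩
    ι (suc δ) - r * ι (suc δ)
      ≡⟨ solve 2 (λ s r → s :- r :* s := (con 1ℚ :- r) :* s) refl (ι (suc δ)) r ⟩
    (1ℚ - r) * ι (suc δ)              ∎))
    where
    q r : ℚ
    q = + 1 / (k ℕ.* suc δ)
    r = + δ / suc δ

  -- Splitting one factor `x` off the power leaves k x ^ δ, which is at most 1 / (δ + 1) = 1 - δ /
  -- (δ + 1). The two terms `x` then cancel.
  excess-bound : ∀ k δ {x} .{{_ : ℕ.NonZero (k ℕ.* suc δ)}} → 0ℚ ≤ x → x ^ δ ≤ + 1 / (k ℕ.* suc δ) →
                 (1ℚ - x) + ι k * x ^ suc δ ≤ 1ℚ - + δ / suc δ * x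
  excess-bound k δ {x} 0≤x x^δ≤q = begin
    (1ℚ - x) + ι k * (x * x ^ δ)
      ≤⟨ +-monoʳ-≤ (1ℚ - x) (*-monoˡ-≤-nonNeg (ι k) {{nonNegative (0≤ι k)}}
           (*-monoˡ-≤-nonNeg x {{nonNegative 0≤x}} x^δ≤q)) ⟩
    (1ℚ - x) + ι k * (x * q)
      ≡⟨ cong (λ z → 1ℚ - x + z) (solve 3 (λ k x q → k :* (x :* q) := x :* (k :* q)) refl (ι k) x q) ⟩
    (1ℚ - x) + x * (ι k * q)
      ≤⟨ +-monoʳ-≤ (1ℚ - x) (*-monoˡ-≤-nonNeg x {{nonNegative 0≤x}} (k/k[1+δ]≤1-δ/[1+δ] k δ)) ⟩
    (1ℚ - x) + x * (1ℚ - r)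
      ≡⟨ solve 2 (λ x r → (con 1ℚ :- x) :+ x :* (con 1ℚ :- r) := con 1ℚ :- r :* x) refl x r ⟩
    1ℚ - r * x                           ∎
    where
    q r : ℚ
    q = + 1 / (k ℕ.* suc δ)
    r = + δ / suc δ

-- Expectation and probability for a random subset.

module RandomSubset where

  open import Data.Bool.Base using (Bool; true; false; if_then_else_; _∨_)
  open import Data.Fin.Base using (Fin; zero; suc)
  open import Data.Fin.Properties using (any?)
  open import Data.Fin.Subset using (Subset; inside; outside; _∈_; _∩_; ∣_∣; Empty)
  open import Data.Fin.Subset.Properties using (_∈?_; nonempty?; drop-∷-Empty)
  open import Data.Nat.Base as ℕ using (ℕ; zero; suc)
  import Data.Nat.Properties as ℕ
  open import Data.Product.Base using (_,_; ∃)
  open import Data.Rational.Base hiding (∣_∣)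
  open import Data.Rational.Properties
  open import Data.Rational.Solver using (module +-*-Solver)
  open import Data.Sum.Base using (inj₁; inj₂)
  open import Data.Vec.Base using ([]; _∷_; tabulate; here)
  open import Function.Base using (_∘_)
  open import Relation.Binary.PropositionalEquality
    using (_≡_; refl; sym; trans; cong; cong₂; subst)
  open import Relation.Nullary.Decidable using (Dec; does; yes; no; ¬?)
  open import Relation.Nullary.Negation using (¬_; contradiction)
  open import Relation.Unary using (Pred; Decidable)
  open import Level using (0ℓ)

  open +-*-Solver using (solve; _:=_; _:+_; _:*_; _:-_; con)
  open ≤-Reasoning
  open Rational

  indicator : Bool → ℕ
  indicator b = if b then 1 else 0

  indicator-∨ : ∀ a b → indicator (a ∨ b) ℕ.≤ indicator a ℕ.+ indicator b
  indicator-∨ true  b = ℕ.s≤s ℕ.z≤n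
  indicator-∨ false b = ℕ.≤-refl

  indicator-mono : ∀ {P Q : Set} (P? : Dec P) (Q? : Dec Q) → (P → Q) →
                   indicator (does P?) ℕ.≤ indicator (does Q?)
  indicator-mono (no _)  _       _   = ℕ.z≤n
  indicator-mono (yes _) (yes _) _   = ℕ.≤-refl
  indicator-mono (yes p) (no ¬q) P⇒Q = contradiction (P⇒Q p) ¬q

  ∣∷∣ : ∀ {n} b (p : Subset n) → ∣ b ∷ p ∣ ≡ indicator b ℕ.+ ∣ p ∣
  ∣∷∣ true  p = refl
  ∣∷∣ false p = refl

  misses? : ∀ {n} (T : Subset n) → Decidable λ S → Empty (T ∩ S)
  misses? T S = ¬? (nonempty? (T ∩ S))

  -- x is the probability of leaving an element out.
  module Bernoulli (x : ℚ) (0≤x : 0ℚ ≤ x) (x≤1 : x ≤ 1ℚ) where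

    0≤1-x : 0ℚ ≤ 1ℚ - x
    0≤1-x = subst (_≤ 1ℚ - x) (+-inverseʳ x) (+-monoˡ-≤ (- x) x≤1)

    mix : ℚ → ℚ → ℚ
    mix a b = (1ℚ - x) * a + x * b

    mix-mono : ∀ {a b c d} → a ≤ c → b ≤ d → mix a b ≤ mix c d
    mix-mono a≤c b≤d = +-mono-≤
      (*-monoˡ-≤-nonNeg (1ℚ - x) {{nonNegative 0≤1-x}} a≤c) (*-monoˡ-≤-nonNeg x {{nonNegative 0≤x}} b≤d)

    mix-diag : ∀ a → mix a a ≡ a
    mix-diag = solve 2 (λ x a → (con 1ℚ :- x) :* a :+ x :* a := a) refl x

    -- Expectation under the product measure, obtained by conditioning on the first element instead
    -- of summing weights over all subsets. Independence of the choices is built into this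
    -- recursion.
    𝔼 : ∀ {n} → (Subset n → ℕ) → ℚ
    𝔼 {zero}  f = ι (f [])
    𝔼 {suc n} f = mix (𝔼 (f ∘ (inside ∷_))) (𝔼 (f ∘ (outside ∷_)))

    𝔼-mono : ∀ {n} {f g : Subset n → ℕ} → (∀ S → f S ℕ.≤ g S) → 𝔼 f ≤ 𝔼 g
    𝔼-mono {zero}  f≤g = ι-mono (f≤g [])
    𝔼-mono {suc n} f≤g = mix-mono (𝔼-mono (f≤g ∘ (inside ∷_))) (𝔼-mono (f≤g ∘ (outside ∷_)))

    𝔼-const : ∀ {n} c → 𝔼 {n} (λ _ → c) ≡ ι c
    𝔼-const {zero}  c = refl
    𝔼-const {suc n} c = trans (cong₂ mix (𝔼-const {n} c) (𝔼-const {n} c)) (mix-diag (ι c))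

    𝔼-+ : ∀ {n} (f g : Subset n → ℕ) → 𝔼 (λ S → f S ℕ.+ g S) ≡ 𝔼 f + 𝔼 g
    𝔼-+ {zero}  f g = ι-+ (f []) (g [])
    𝔼-+ {suc n} f g = trans
      (cong₂ mix (𝔼-+ (f ∘ (inside ∷_)) (g ∘ (inside ∷_))) (𝔼-+ (f ∘ (outside ∷_)) (g ∘ (outside ∷_))))
      (solve 6 (λ p x a b c d → p :* (a :+ b) :+ x :* (c :+ d) := (p :* a :+ x :* c) :+ (p :* b :+ x :* d))
        refl (1ℚ - x) x _ _ _ _)

    -- Method of conditional expectations: the branch with the smaller conditional expectation lies
    -- at or below the weighted mean of the two, so it is followed element by element.
    ∃≤𝔼 : ∀ {n} (f : Subset n → ℕ) → ∃ λ S → ι (f S) ≤ 𝔼 f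
    ∃≤𝔼 {zero}  f = [] , ≤-refl
    ∃≤𝔼 {suc n} f with ≤-total (𝔼 (f ∘ (inside ∷_))) (𝔼 (f ∘ (outside ∷_)))
    ... | inj₁ in≤out with S , fS≤ ← ∃≤𝔼 (f ∘ (inside ∷_)) = inside ∷ S ,
      ≤-trans fS≤ (subst (_≤ 𝔼 f) (mix-diag _) (mix-mono ≤-refl in≤out))
    ... | inj₂ out≤in with S , fS≤ ← ∃≤𝔼 (f ∘ (outside ∷_)) = outside ∷ S ,
      ≤-trans fS≤ (subst (_≤ 𝔼 f) (mix-diag _) (mix-mono out≤in ≤-refl))

    ℙ : ∀ {n} {P : Pred (Subset n) 0ℓ} → Decidable P → ℚ
    ℙ P? = 𝔼 λ S → indicator (does (P? S))

    ℙ-mono : ∀ {n} {P Q : Pred (Subset n) 0ℓ} (P? : Decidable P) (Q? : Decidable Q) →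
             (∀ S → P S → Q S) → ℙ P? ≤ ℙ Q?
    ℙ-mono P? Q? P⇒Q = 𝔼-mono λ S → indicator-mono (P? S) (Q? S) (P⇒Q S)

    ℙ-impossible : ∀ {n} {P : Pred (Subset n) 0ℓ} (P? : Decidable P) → (∀ S → ¬ P S) → ℙ P? ≤ 0ℚ
    ℙ-impossible {n} P? ¬P = ≤-trans
      -- `no λ ()` decides the empty type, so the comparison is with an indicator that is constantly
      -- 0.
      (𝔼-mono λ S → indicator-mono (P? S) (no λ ()) (¬P S)) (≤-reflexive (𝔼-const {n} 0))

    𝔼-∨ : ∀ {n} (a b : Subset n → Bool) →
          𝔼 (λ S → indicator (a S ∨ b S)) ≤ 𝔼 (indicator ∘ a) + 𝔼 (indicator ∘ b)
    𝔼-∨ a b = ≤-trans (𝔼-mono λ S → indicator-∨ (a S) (b S)) (≤-reflexive (𝔼-+ (indicator ∘ a) (indicator ∘ b)))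

    ι-suc-* : ∀ n c → c + ι n * c ≡ ι (suc n) * c
    ι-suc-* n c = trans (solve 2 (λ n c → c :+ n :* c := (con 1ℚ :+ n) :* c) refl (ι n) c)
                        (cong (_* c) (sym (ι-+ 1 n)))

    ℙ-any : ∀ {n c} k {P : Fin k → Pred (Subset n) 0ℓ} (P? : ∀ i → Decidable (P i)) →
            (∀ i → ℙ (P? i) ≤ c) → ℙ (λ S → any? λ i → P? i S) ≤ ι k * c
    ℙ-any {n} {c} zero P? bound = ≤-reflexive (trans (𝔼-const {n} 0) (sym (*-zeroˡ c)))
    ℙ-any {n} {c} (suc k) P? bound = begin
      ℙ (λ S → any? λ i → P? i S)
        -- The boolean of `any?` computes to a disjunction of the first event with the rest, so the
        -- union bound for two events applies.
        ≤⟨ 𝔼-∨ (λ S → does (P? zero S)) (λ S → does (any? λ i → P? (suc i) S)) ⟩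
      ℙ (P? zero) + ℙ (λ S → any? λ i → P? (suc i) S)
        ≤⟨ +-mono-≤ (bound zero) (ℙ-any k (P? ∘ suc) (bound ∘ suc)) ⟩
      c + ι k * c      ≡⟨ ι-suc-* k c ⟩
      ι (suc k) * c    ∎

    -- Linearity of expectation: the size of a random set is the sum of the indicators of
    -- membership.
    𝔼-∣tabulate∣ : ∀ {n c} m (b : Fin m → Subset n → Bool) → (∀ v → 𝔼 (indicator ∘ b v) ≤ c) →
                   𝔼 (λ S → ∣ tabulate (λ v → b v S) ∣) ≤ ι m * c
    𝔼-∣tabulate∣ {n} {c} zero b bound = ≤-reflexive (trans (𝔼-const {n} 0) (sym (*-zeroˡ c)))
    𝔼-∣tabulate∣ {n} {c} (suc m) b bound = begin
      𝔼 (λ S → ∣ tabulate (λ v → b v S) ∣)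
        ≤⟨ 𝔼-mono (λ S → ℕ.≤-reflexive (∣∷∣ (b zero S) (tabulate λ v → b (suc v) S))) ⟩
      𝔼 (λ S → indicator (b zero S) ℕ.+ ∣ tabulate (λ v → b (suc v) S) ∣)
        ≡⟨ 𝔼-+ (indicator ∘ b zero) (λ S → ∣ tabulate (λ v → b (suc v) S) ∣) ⟩
      𝔼 (indicator ∘ b zero) + 𝔼 (λ S → ∣ tabulate (λ v → b (suc v) S) ∣)
        ≤⟨ +-mono-≤ (bound zero) (𝔼-∣tabulate∣ m (b ∘ suc) (bound ∘ suc)) ⟩
      c + ι m * c      ≡⟨ ι-suc-* m c ⟩
      ι (suc m) * c    ∎

    ℙ-∈ : ∀ {n} (v : Fin n) → ℙ (λ S → v ∈? S) ≡ 1ℚ - x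
    ℙ-∈ {suc n} zero = trans (cong₂ mix (𝔼-const {n} 1) (𝔼-const {n} 0))
      (solve 2 (λ p x → p :* con 1ℚ :+ x :* con 0ℚ := p) refl (1ℚ - x) x)
    ℙ-∈ (suc v) = trans (cong₂ mix (ℙ-∈ v) (ℙ-∈ v)) (mix-diag (1ℚ - x))

    -- Each element of `T` must be left out and contributes a factor `x`; an element outside `T` has
    -- no influence, and its two branches average to the same value.
    ℙ-misses : ∀ {n} (T : Subset n) → ℙ (misses? T) ≤ x ^ ∣ T ∣
    ℙ-misses [] = ≤-refl
    ℙ-misses (outside ∷ T) = begin
      ℙ (misses? (outside ∷ T))
        ≤⟨ mix-mono (ℙ-mono (misses? (outside ∷ T) ∘ (inside ∷_)) (misses? T) (λ _ → drop-∷-Empty))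
                    (ℙ-mono (misses? (outside ∷ T) ∘ (outside ∷_)) (misses? T) (λ _ → drop-∷-Empty)) ⟩
      mix (ℙ (misses? T)) (ℙ (misses? T))    ≡⟨ mix-diag (ℙ (misses? T)) ⟩
      ℙ (misses? T)                          ≤⟨ ℙ-misses T ⟩
      x ^ ∣ T ∣                              ∎
    ℙ-misses (inside ∷ T) = begin
      ℙ (misses? (inside ∷ T))
        -- Choosing this element of `T` already makes the intersection nonempty, so only the branch
        -- of weight `x` survives.
        ≤⟨ mix-mono (ℙ-impossible (misses? (inside ∷ T) ∘ (inside ∷_)) (λ _ empty → empty (zero , here)))
                    (ℙ-mono (misses? (inside ∷ T) ∘ (outside ∷_)) (misses? T) (λ _ → drop-∷-Empty)) ⟩
      mix 0ℚ (ℙ (misses? T))                 ≤⟨ mix-mono ≤-refl (ℙ-misses T) ⟩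
      mix 0ℚ (x ^ ∣ T ∣)                     ≡⟨ solve 3 (λ p x y → p :* con 0ℚ :+ x :* y := x :* y) refl (1ℚ - x) x (x ^ ∣ T ∣) ⟩
      x * x ^ ∣ T ∣                          ∎

-- From a random set to a simultaneous dominating set.

module Domination where

  open import Data.Fin.Base using (Fin)
  open import Data.Fin.Properties using (any?)
  import Data.Fin.Subset as Subset
  open import Data.Fin.Subset using (Subset; inside; _∈_; _∉_; _⊆_; _∩_; _∪_; ⁅_⁆; ∣_∣; Empty)
  open import Data.Fin.Subset.Properties
  open import Data.Nat.Base as ℕ using (ℕ; suc)
  import Data.Nat.Properties as ℕ
  open import Data.Product.Base using (_×_; _,_; proj₂; ∃)
  open import Data.Sum.Base using (_⊎_; inj₁; inj₂)
  open import Data.Vec.Base using (tabulate)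
  open import Data.Vec.Properties using (lookup∘tabulate; lookup⇒[]=; []=⇒lookup)
  open import Function.Base using (_∘_)
  open import Relation.Binary.PropositionalEquality using (_≡_; refl; sym; trans; subst)
  open import Relation.Nullary.Decidable using (Dec; does; yes; dec-true; _⊎-dec_; decidable-stable)
  open import Relation.Nullary.Negation using (contradiction)
  open import Data.Rational.Base hiding (∣_∣)
  open import Data.Rational.Properties
  open import Data.Integer.Base using (+_)

  open ≤-Reasoning
  open Rational
  open RandomSubset

  does⇒ : ∀ {P : Set} (P? : Dec P) → does P? ≡ inside → P
  does⇒ (yes p) refl = p

  module _ {n} {P : Fin n → Set} (P? : ∀ v → Dec (P v)) where

    ∈-tabulate⁺ : ∀ {v} → P v → v ∈ tabulate (does ∘ P?)
    ∈-tabulate⁺ {v} p = lookup⇒[]= v _ (trans (lookup∘tabulate _ v) (dec-true (P? v) p))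

    ∈-tabulate⁻ : ∀ {v} → v ∈ tabulate (does ∘ P?) → P v
    ∈-tabulate⁻ {v} v∈ = does⇒ (P? v) (trans (sym (lookup∘tabulate _ v)) ([]=⇒lookup v∈))

  N[_,_] : ∀ {n} → Graph n → Fin n → Subset n
  N[ G , v ] = ⁅ v ⁆ ∪ neighbours G v

  -- By irreflexivity `v` is not its own neighbour, so all neighbours survive the removal of `v`
  -- from the closed neighbourhood, while the size drops strictly. This supplies the exponent δ + 1.
  degree<∣N∣ : ∀ {n} (G : Graph n) v → degree G v ℕ.< ∣ N[ G , v ] ∣
  degree<∣N∣ G v = ℕ.≤-<-trans (p⊆q⇒∣p∣≤∣q∣ N⊆) (x∈p⇒∣p-x∣<∣p∣ (p⊆p∪q (neighbours G v) (x∈⁅x⁆ v)))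
    where
    N⊆ : neighbours G v ⊆ N[ G , v ] Subset.- v
    N⊆ u∈N = x∈p∧x≢y⇒x∈p-y (q⊆p∪q ⁅ v ⁆ (neighbours G v) u∈N)
      λ { refl → irrefl G (∈-tabulate⁻ (adj? G v) u∈N) }

  module _ {k n} (F : Fin k → Graph n) where

    -- With closed neighbourhoods the second case also demands that `v` itself be left out, which
    -- makes it rarer by a factor `x`.
    Added : Fin n → Subset n → Set
    Added v S = v ∈ S ⊎ ∃ λ i → Empty (N[ F i , v ] ∩ S)

    added? : ∀ v S → Dec (Added v S)
    added? v S = (v ∈? S) ⊎-dec any? λ i → misses? N[ F i , v ] S

    completion : Subset n → Subset n
    completion S = tabulate λ v → does (added? v S)

    -- For a vertex outside the completion, the closed neighbourhood in every factor meets `S`. The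
    -- common vertex cannot be `v`, since `S` lies in the completion, so it is a neighbour in the
    -- completion.
    completion-dominating : ∀ S → SimDominating F (completion S)
    completion-dominating S i v v∉D = from-hit
      -- Being outside the completion only refutes emptiness; decidability turns this into an actual
      -- common vertex.
      (decidable-stable (nonempty? (N[ F i , v ] ∩ S)) λ empty → v∉D (∈-D (inj₂ (i , empty))))
      where
      ∈-D : ∀ {u} → Added u S → u ∈ completion S
      ∈-D = ∈-tabulate⁺ λ u → added? u S
      from-hit : (∃ λ u → u ∈ N[ F i , v ] ∩ S) → ∃ λ u → u ∈ completion S × Adj (F i) v u
      from-hit (u , u∈) with u∈N , u∈S ← x∈p∩q⁻ N[ F i , v ] S u∈
                        with x∈p∪q⁻ ⁅ v ⁆ (neighbours (F i) v) u∈N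
      ... | inj₁ u∈⁅v⁆ = contradiction
        (∈-D (inj₁ (subst (_∈ S) (x∈⁅y⁆⇒x≡y v u∈⁅v⁆) u∈S))) v∉D
      ... | inj₂ u~v   = u , ∈-D (inj₁ u∈S) , ∈-tabulate⁻ (adj? (F i) v) u~v

    γsd-min : ∀ S → SimDominating F S → γsd F ℕ.≤ ∣ S ∣
    γsd-min = proj₂ (proj₂ (simDomNumber F))

    module _ {δ x} (minDegree : ∀ i → MinDegree≥ δ (F i)) (0≤x : 0ℚ ≤ x) (x≤1 : x ≤ 1ℚ) where

      open Bernoulli x 0≤x x≤1

      -- The closed neighbourhood has at least δ + 1 elements, and powers of `x` decrease in the
      -- exponent on [0 , 1].
      ℙ-missed : ∀ i v → ℙ (misses? N[ F i , v ]) ≤ x ^ suc δ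
      ℙ-missed i v = ≤-trans (ℙ-misses N[ F i , v ])
        (^-anti 0≤x x≤1 (ℕ.≤-<-trans (minDegree i v) (degree<∣N∣ (F i) v)))

      ℙ-added : ∀ v → ℙ (added? v) ≤ (1ℚ - x) + ι k * x ^ suc δ
      ℙ-added v = begin
        ℙ (added? v)
          ≤⟨ 𝔼-∨ (λ S → does (v ∈? S)) (λ S → does (any? λ i → misses? N[ F i , v ] S)) ⟩
        ℙ (v ∈?_) + ℙ (λ S → any? λ i → misses? N[ F i , v ] S)
          ≤⟨ +-mono-≤ (≤-reflexive (ℙ-∈ v)) (ℙ-any k (λ i → misses? N[ F i , v ]) (λ i → ℙ-missed i v)) ⟩
        (1ℚ - x) + ι k * x ^ suc δ    ∎

      γsd≤ : ι (γsd F) ≤ ι n * ((1ℚ - x) + ι k * x ^ suc δ)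
      γsd≤ with S , D≤ ← ∃≤𝔼 (∣_∣ ∘ completion) = begin
        ι (γsd F)                            ≤⟨ ι-mono (γsd-min (completion S) (completion-dominating S)) ⟩
        ι ∣ completion S ∣                   ≤⟨ D≤ ⟩
        𝔼 (∣_∣ ∘ completion)                 ≤⟨ 𝔼-∣tabulate∣ n (λ v S → does (added? v S)) ℙ-added ⟩
        ι n * ((1ℚ - x) + ι k * x ^ suc δ)   ∎

    γsd-bound : ∀ {δ x} .{{_ : ℕ.NonZero δ}} .{{_ : ℕ.NonZero (k ℕ.* suc δ)}} →
                (∀ i → MinDegree≥ δ (F i)) → 0ℚ ≤ x → x ^ δ ≤ + 1 / (k ℕ.* suc δ) →
                ι (γsd F) ≤ (1ℚ - + δ / suc δ * x) * ι n
    γsd-bound {δ} {x} minDegree 0≤x x^δ≤q = begin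
      ι (γsd F)
        -- The bound x ≤ 1 comes from x ^ δ ≤ 1 / (k (δ + 1)) ≤ 1.
        ≤⟨ γsd≤ minDegree 0≤x (^-≤1⁻¹ δ (≤-trans x^δ≤q (1/n≤1 (k ℕ.* suc δ)))) ⟩
      ι n * ((1ℚ - x) + ι k * x ^ suc δ)
        ≤⟨ *-monoˡ-≤-nonNeg (ι n) {{nonNegative (0≤ι n)}} (excess-bound k δ 0≤x x^δ≤q) ⟩
      ι n * (1ℚ - + δ / suc δ * x)            ≡⟨ *-comm (ι n) _ ⟩
      (1ℚ - + δ / suc δ * x) * ι n            ∎

-- The bound over the reals.

open import Data.Fin.Base using (Fin)
open import Data.Integer.Base using (+_)
open import Data.Nat.Base using (ℕ; suc; _≤_; _*_)
open import Data.Rational.Base using (_/_; 1ℚ)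
import Data.Nat.Base as ℕ
open import Data.Product.Base using (_,_)

theorem12 : ∀ (k δ n : ℕ) (2≤k : 2 ≤ k) → 1 ≤ δ →
    (F : Fin k → Graph n) → (∀ i → MinDegree≥ δ (F i)) →
    let instance _ = k[1+δ]≢0 δ 2≤k in
    fromℕ (γsd F) ≤ᵣ
    (fromℚ 1ℚ -ᵣ fromℚ (+ δ / suc δ) *ᵣ root δ (+ 1 / (k * suc δ))) *ᵣ fromℕ n
theorem12 k δ n 2≤k 1≤δ F minDegree ε 0<ε = 0 , λ m _ →
  -- At index `m` the right-hand side computes to the rational bound with `x` the `m`-th lower
  -- approximation of the root. The inequality holds there for every `m`, so the threshold is 0 and
  -- the slack `ε` is simply added.
  Rational.p≤q⇒p≤q+ε 0<ε
    (Domination.γsd-bound F minDegree (Bisection.0≤lower δ q m)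
      (Bisection.lower^≤q δ q (Rational.0≤1/n (k * suc δ)) m))
  where
  instance
    δ≢0 : ℕ.NonZero δ
    δ≢0 = ℕ.>-nonZero 1≤δ
    k[1+δ]-nonZero : ℕ.NonZero (k * suc δ)
    k[1+δ]-nonZero = k[1+δ]≢0 δ 2≤k
  q = + 1 / (k * suc δ)
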